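{- Let $S=\{b_1,\ldots,b_k\}\subseteq\mathcal{P}$ be a finite set of perfect integer powers (with $b_1,\ldots,b_k$ distinct). Define polynomials in $\mathbb{Z}[x]$ by \[ g(x)=\bigl((x-b_1)\cdots(x-b_k)\bigr)^4+1,\qquad f_S(x)=g(x)\bigl((x-1)g(x)+1\bigr). \] Then: (i) for every $x\in\mathbb{Z}$, $f_S(x)\in\mathcal{P}$ if and only if $x\in S$; (ii) $f_S(\mathbb{Z})\cap\mathcal{P}=S$.
   Context: $\mathcal{P}=\{a^m : a\in\mathbb{Z},\ m\in\mathbb{Z},\ m\geq 2\}\subseteq\mathbb{Z}$ denotes the set of all perfect integer powers. For a polynomial $f\in\mathbb{Z}[x]$, $f(\mathbb{Z})=\{f(n): n\in\mathbb{Z}\}$. An empty product equals $1$. -}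

module Defs where

open import Data.Integer.Base using (ℤ; +_; -_; _+_; _*_; _^_; 0ℤ; 1ℤ)
open import Data.List.Base using (List; []; _∷_; map; foldr)
open import Data.Nat.Base as ℕ using (ℕ; zero; suc)
open import Data.Product.Base using (∃; ∃₂; _×_)
open import Level using (0ℓ)
open import Relation.Binary.PropositionalEquality.Core using (_≡_)
open import Relation.Unary using (Pred)

-- An exponent m ∈ ℤ with m ≥ 2 is the same thing as a natural number m ≥ 2.
PerfectPower : Pred ℤ 0ℓ
PerfectPower z = ∃₂ λ (a : ℤ) (m : ℕ) → 2 ℕ.≤ m × z ≡ a ^ m

-- ℤ[x] as coefficient lists, constant term first.  Trailing zeros are
-- allowed, so a polynomial has several representatives; they all evaluate
-- to the same function.
ℤ[x] : Set
ℤ[x] = List ℤ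

infixl 6 _⊕_
infixl 7 _⊗_
infixr 8 _↑_

const : ℤ → ℤ[x]
const c = c ∷ []

X-_ : ℤ → ℤ[x]
X- b = - b ∷ 1ℤ ∷ []

_⊕_ : ℤ[x] → ℤ[x] → ℤ[x]
[]      ⊕ q       = q
(a ∷ p) ⊕ []      = a ∷ p
(a ∷ p) ⊕ (b ∷ q) = (a + b) ∷ (p ⊕ q)

-- (a + x p) q = a q + x (p q)
_⊗_ : ℤ[x] → ℤ[x] → ℤ[x]
[]      ⊗ q = []
(a ∷ p) ⊗ q = map (a *_) q ⊕ (0ℤ ∷ (p ⊗ q))

_↑_ : ℤ[x] → ℕ → ℤ[x]
p ↑ zero  = const 1ℤ
p ↑ suc n = p ⊗ p ↑ n

∏ : List ℤ[x] → ℤ[x]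
∏ = foldr _⊗_ (const 1ℤ)

eval : ℤ[x] → ℤ → ℤ
eval []      n = 0ℤ
eval (a ∷ p) n = a + n * eval p n

Values : ℤ[x] → Pred ℤ 0ℓ
Values p y = ∃ λ (n : ℤ) → y ≡ eval p n

g : List ℤ → ℤ[x]
g S = ∏ (map X-_ S) ↑ 4 ⊕ const 1ℤ

f : List ℤ → ℤ[x]
f S = g S ⊗ ((X- 1ℤ) ⊗ g S ⊕ const 1ℤ)

{-# OPTIONS --safe #-}
-- On S the product y = (x - b₁) ⋯ (x - bₖ) vanishes, so g(x) = 1 and f(x) = x.
-- Conversely let g ((x - 1) g + 1) = aᵐ with g = y⁴ + 1.  If y is odd the left
-- side is 2 mod 4.  If y is even, u = y² + i is coprime in ℤ[i] to its conjugate,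
-- and to (x - 1) g + 1 because g = u ū.  Hence u = r dᵐ with r a unit, and it
-- remains to prove Lebesgue's theorem that z + i = r dᵐ with z even forces z = 0.
-- For even m the norms z² + 1 and (N d)ᵐ are both squares.  For odd m a rotation
-- makes d = α + β i with α odd, β even; comparing real and imaginary parts gives
-- α = ± 1 and (Re dᵐ)² = 1, whereas Re dᵐ = ± (1 - β² K) with K ≠ 0 by a 2-adic
-- computation.  So β = 0 and z² + 1 = N(r dᵐ) = 1.
module Submission where

open import Defs
open import Algebra.Bundles using (CommutativeSemiring)
open import Data.Nat.Base as ℕ using (ℕ; zero; suc; NonZero)
open import Data.Product.Base using (∃; ∃₂; _×_; _,_)

-- Coprimality and powers in commutative semirings.

module CoprimePowers {c ℓ} (R : CommutativeSemiring c ℓ) where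
  open CommutativeSemiring R
  open import Algebra.Properties.CommutativeSemiring.Exp R
  open import Algebra.Properties.Semiring.Divisibility semiring
  open import Algebra.Properties.CommutativeSemigroup.Divisibility *-commutativeSemigroup
    using (∙-cong-∣)
  open import Algebra.Solver.Ring.NaturalCoefficients.Default R
  open import Relation.Binary.Reasoning.Setoid setoid

  Coprime : Carrier → Carrier → Set _
  Coprime u v = ∃₂ λ s t → s * u + t * v ≈ 1#

  coprime-sym : ∀ {u v} → Coprime u v → Coprime v u
  coprime-sym (s , t , eq) = t , s , trans (+-comm _ _) eq

  -- Multiply the two Bézout identities: one term of the product contains `u * v`, and the other
  -- three contain `w`.
  coprime-* : ∀ {u v w} → Coprime u w → Coprime v w → Coprime (u * v) w
  coprime-* {u} {v} {w} (s , t , eq) (s′ , t′ , eq′) =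
    s * s′ , s * u * t′ + t * s′ * v + t * t′ * w , (begin
      s * s′ * (u * v) + (s * u * t′ + t * s′ * v + t * t′ * w) * w
        ≈⟨ solve 7 (λ s t s′ t′ u v w →
             s :* s′ :* (u :* v) :+ (s :* u :* t′ :+ t :* s′ :* v :+ t :* t′ :* w) :* w
             := (s :* u :+ t :* w) :* (s′ :* v :+ t′ :* w)) refl s t s′ t′ u v w ⟩
      (s * u + t * w) * (s′ * v + t′ * w)  ≈⟨ *-cong eq eq′ ⟩
      1# * 1#                              ≈⟨ *-identityˡ 1# ⟩
      1#                                   ∎)

  coprime-^ : ∀ {u w} → Coprime u w → ∀ n → Coprime (u ^ n) w
  coprime-^ {w = w} cop zero    =
    1# , 0# , solve 1 (λ w → con 1 :* con 1 :+ con 0 :* w := con 1) refl w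
  coprime-^         cop (suc n) = coprime-* cop (coprime-^ cop n)

  ∣-coprime : ∀ {d u v} → d ∣ u → Coprime u v → Coprime d v
  ∣-coprime {d} {u} {v} (q , qd≈u) (s , t , eq) =
    s * q , t , trans (+-congʳ (trans (*-assoc s q d) (*-congˡ qd≈u))) eq

  -- Multiplying the Bézout identity by `u` gives `u = u * s * d + t * (u * v)`, and `d` divides
  -- both terms.
  coprime-∣ : ∀ {d u v} → Coprime d v → d ∣ u * v → d ∣ u
  coprime-∣ {d} {u} {v} (s , t , eq) (q , qd≈uv) = u * s + t * q , (begin
    (u * s + t * q) * d        ≈⟨ solve 5 (λ u s t q d →
                                    (u :* s :+ t :* q) :* d := u :* (s :* d) :+ t :* (q :* d))
                                    refl u s t q d ⟩
    u * (s * d) + t * (q * d)  ≈⟨ +-congˡ (*-congˡ qd≈uv) ⟩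
    u * (s * d) + t * (u * v)  ≈⟨ solve 5 (λ u s t d v →
                                    u :* (s :* d) :+ t :* (u :* v) := u :* (s :* d :+ t :* v))
                                    refl u s t d v ⟩
    u * (s * d + t * v)        ≈⟨ *-congˡ eq ⟩
    u * 1#                     ≈⟨ *-identityʳ u ⟩
    u                          ∎)

  ^-∣-^ : ∀ {x y} → x ∣ y → ∀ n → x ^ n ∣ y ^ n
  ^-∣-^ x∣y zero    = 1# , *-identityˡ 1#
  ^-∣-^ x∣y (suc n) = ∙-cong-∣ x∣y (^-∣-^ x∣y n)

  -- An explicit quotient stands for the congruence modulo `x`, since a semiring has no subtraction.
  -- Every binomial term except `y ^ n` contains `x`.
  [px+y]^n≈qx+y^n : ∀ p x y n → ∃ λ q → (p * x + y) ^ n ≈ q * x + y ^ n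
  [px+y]^n≈qx+y^n p x y zero    =
    0# , solve 1 (λ x → con 1 := con 0 :* x :+ con 1) refl x
  [px+y]^n≈qx+y^n p x y (suc n) = let (q , eq) = [px+y]^n≈qx+y^n p x y n in
    p * (q * x + y ^ n) + y * q , (begin
      (p * x + y) * (p * x + y) ^ n      ≈⟨ *-congˡ eq ⟩
      (p * x + y) * (q * x + y ^ n)      ≈⟨ solve 5 (λ p q x y z →
                                              (p :* x :+ y) :* (q :* x :+ z)
                                              := (p :* (q :* x :+ z) :+ y :* q) :* x :+ y :* z)
                                              refl p q x y (y ^ n) ⟩
      (p * (q * x + y ^ n) + y * q) * x + y * y ^ n  ∎)

  -- Here `d` is a greatest common divisor of `u` and `c`. As `d` divides `u`, its power `d ^ n` is
  -- coprime to `v`; it divides `c ^ n = u * v`, hence `u`. Conversely, modulo `u` the power `d ^ n`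
  -- is congruent to `(t * c) ^ n = t ^ n * (u * v)`, hence to 0.
  coprime-factor-^ : ∀ {u v c d} s t n → Coprime u v → u * v ≈ c ^ n →
    d ≈ s * u + t * c → d ∣ u → d ∣ c → d ^ n ∣ u × u ∣ d ^ n
  coprime-factor-^ {u} {v} {c} {d} s t n cop uv≈cⁿ bezout d∣u d∣c =
      coprime-∣ (coprime-^ (∣-coprime d∣u cop) n) (∣-respʳ (sym uv≈cⁿ) (^-∣-^ d∣c n))
    , (let (q , eq) = [px+y]^n≈qx+y^n s u (t * c) n in q + t ^ n * v , (begin
        (q + t ^ n * v) * u        ≈⟨ solve 4 (λ q z v u →
                                        (q :+ z :* v) :* u := q :* u :+ z :* (u :* v))
                                        refl q (t ^ n) v u ⟩
        q * u + t ^ n * (u * v)    ≈⟨ +-congˡ (*-congˡ uv≈cⁿ) ⟩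
        q * u + t ^ n * c ^ n      ≈⟨ +-congˡ (^-distrib-* t c n) ⟨
        q * u + (t * c) ^ n        ≈⟨ eq ⟨
        (s * u + t * c) ^ n        ≈⟨ ^-congˡ n bezout ⟨
        d ^ n                      ∎))

open import Algebra.Structures.Biased using (isCommutativeSemiringˡ)
open import Data.Empty using (⊥)
open import Data.Integer.Base as ℤ
  using (ℤ; +_; -[1+_]; -_; _+_; _*_; _-_; _^_; 0ℤ; 1ℤ; -1ℤ; ∣_∣)
open import Data.Integer.DivMod using (_/ℕ_; _%ℕ_; a≡a%ℕn+[a/ℕn]*n; n%ℕd<d)
import Data.Integer.Properties as ℤ
open import Data.Integer.Tactic.RingSolver using (solve-∀)
open import Data.List.Base using (List; []; _∷_; map)
open import Data.List.Membership.Propositional using (_∈_)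
open import Data.List.Relation.Unary.All as All using (All)
open import Data.List.Relation.Unary.Any using (here; there)
open import Data.List.Relation.Unary.Unique.Propositional using (Unique)
open import Data.Nat.Induction using (<-wellFounded)
import Data.Nat.Properties as ℕ
open import Data.Sum.Base using (_⊎_; inj₁; inj₂; [_,_]′)
open import Function.Base using (id)
open import Function.Bundles using (_⇔_; mk⇔)
open import Induction.WellFounded using (Acc; acc)
open import Level using (0ℓ)
open import Relation.Binary.PropositionalEquality
  using (_≡_; _≢_; refl; sym; trans; cong; cong₂; subst; isEquivalence; module ≡-Reasoning)
open import Relation.Nullary using (yes; no; contradiction)
open import Relation.Unary using (_∩_; _≐_)

-- The Gaussian integers as a commutative semiring.

infix 5 _+i_

record ℤ[i] : Set where
  constructor _+i_
  field
    re im : ℤ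

open ℤ[i]

infixl 6 _⊞_
infixl 7 _⊠_

_⊞_ _⊠_ : ℤ[i] → ℤ[i] → ℤ[i]
(a +i b) ⊞ (c +i d) = (a + c) +i (b + d)
(a +i b) ⊠ (c +i d) = (a * c - b * d) +i (a * d + b * c)

0ᵍ 1ᵍ 𝕚 : ℤ[i]
0ᵍ = 0ℤ +i 0ℤ
1ᵍ = 1ℤ +i 0ℤ
𝕚  = 0ℤ +i 1ℤ

ℤ[i]-commutativeSemiring : CommutativeSemiring 0ℓ 0ℓ
ℤ[i]-commutativeSemiring = record
  { _+_ = _⊞_ ; _*_ = _⊠_ ; 0# = 0ᵍ ; 1# = 1ᵍ
  ; isCommutativeSemiring = isCommutativeSemiringˡ record
    { +-isCommutativeMonoid = record
      { isMonoid = record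
        { isSemigroup = record
          { isMagma = record { isEquivalence = isEquivalence ; ∙-cong = cong₂ _⊞_ }
          ; assoc   = λ (a +i b) (c +i d) (e +i f) →
              cong₂ _+i_ (ℤ.+-assoc a c e) (ℤ.+-assoc b d f)
          }
        ; identity = (λ (a +i b) → cong₂ _+i_ (ℤ.+-identityˡ a) (ℤ.+-identityˡ b))
                   , (λ (a +i b) → cong₂ _+i_ (ℤ.+-identityʳ a) (ℤ.+-identityʳ b))
        }
      ; comm = λ (a +i b) (c +i d) → cong₂ _+i_ (ℤ.+-comm a c) (ℤ.+-comm b d)
      }
    ; *-isCommutativeMonoid = record
      { isMonoid = record
        { isSemigroup = record
          { isMagma = record { isEquivalence = isEquivalence ; ∙-cong = cong₂ _⊠_ }
          ; assoc   = λ (a +i b) (c +i d) (e +i f) →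
              cong₂ _+i_ (assoc-re a b c d e f) (assoc-im a b c d e f)
          }
        ; identity = (λ (a +i b) → cong₂ _+i_ (identityˡ-re a b) (identityˡ-im a b))
                   , (λ (a +i b) → cong₂ _+i_ (identityʳ-re a b) (identityʳ-im a b))
        }
      ; comm = λ (a +i b) (c +i d) → cong₂ _+i_ (comm-re a b c d) (comm-im a b c d)
      }
    ; distribʳ = λ (a +i b) (c +i d) (e +i f) →
        cong₂ _+i_ (distribʳ-re a b c d e f) (distribʳ-im a b c d e f)
    ; zeroˡ = λ _ → refl
    }
  }
  where
  assoc-re : ∀ a b c d e f →
    (a * c - b * d) * e - (a * d + b * c) * f ≡ a * (c * e - d * f) - b * (c * f + d * e)
  assoc-re = solve-∀
  assoc-im : ∀ a b c d e f →
    (a * c - b * d) * f + (a * d + b * c) * e ≡ a * (c * f + d * e) + b * (c * e - d * f)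
  assoc-im = solve-∀
  identityˡ-re : ∀ a b → 1ℤ * a - 0ℤ * b ≡ a
  identityˡ-re = solve-∀
  identityˡ-im : ∀ a b → 1ℤ * b + 0ℤ * a ≡ b
  identityˡ-im = solve-∀
  identityʳ-re : ∀ a b → a * 1ℤ - b * 0ℤ ≡ a
  identityʳ-re = solve-∀
  identityʳ-im : ∀ a b → a * 0ℤ + b * 1ℤ ≡ b
  identityʳ-im = solve-∀
  comm-re : ∀ a b c d → a * c - b * d ≡ c * a - d * b
  comm-re = solve-∀
  comm-im : ∀ a b c d → a * d + b * c ≡ c * b + d * a
  comm-im = solve-∀
  distribʳ-re : ∀ a b c d e f →
    (c + e) * a - (d + f) * b ≡ (c * a - d * b) + (e * a - f * b)
  distribʳ-re = solve-∀
  distribʳ-im : ∀ a b c d e f →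
    (c + e) * b + (d + f) * a ≡ (c * b + d * a) + (e * b + f * a)
  distribʳ-im = solve-∀

module 𝔾 where
  open CommutativeSemiring ℤ[i]-commutativeSemiring public
    using (*-assoc; *-identityʳ; semiring)
  open import Algebra.Properties.CommutativeSemiring.Exp ℤ[i]-commutativeSemiring public
  open import Algebra.Properties.Semiring.Divisibility semiring public
    using (_∣_; _,_; ∣-refl; _∣0)
  open CoprimePowers ℤ[i]-commutativeSemiring public

open 𝔾 using (Coprime; _,_) renaming (_^_ to _^ᵍ_; _∣_ to _∣ᵍ_)

-- Norms and division with remainder in ℤ[i].

norm : ℤ[i] → ℤ
norm (a +i b) = a * a + b * b

norm-⊠ : ∀ z w → norm (z ⊠ w) ≡ norm z * norm w
norm-⊠ (a +i b) (c +i d) = identity a b c d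
  where
  identity : ∀ a b c d →
    (a * c - b * d) * (a * c - b * d) + (a * d + b * c) * (a * d + b * c)
    ≡ (a * a + b * b) * (c * c + d * d)
  identity = solve-∀

norm-^ : ∀ z n → norm (z ^ᵍ n) ≡ norm z ^ n
norm-^ z zero    = refl
norm-^ z (suc n) = trans (norm-⊠ z (z ^ᵍ n)) (cong (norm z *_) (norm-^ z n))

-- The norm in ℕ serves as the measure for Euclid's algorithm and lets factorisations of 1 be
-- settled among natural numbers.
∥_∥ : ℤ[i] → ℕ
∥ a +i b ∥ = ∣ a ∣ ℕ.* ∣ a ∣ ℕ.+ ∣ b ∣ ℕ.* ∣ b ∣

+∣i∣²≡i² : ∀ i → + (∣ i ∣ ℕ.* ∣ i ∣) ≡ i * i
+∣i∣²≡i² (+ n)    = ℤ.pos-* n n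
+∣i∣²≡i² -[1+ n ] = refl

+∥z∥≡norm : ∀ z → + ∥ z ∥ ≡ norm z
+∥z∥≡norm (a +i b) =
  trans (ℤ.pos-+ (∣ a ∣ ℕ.* ∣ a ∣) (∣ b ∣ ℕ.* ∣ b ∣)) (cong₂ _+_ (+∣i∣²≡i² a) (+∣i∣²≡i² b))

∥z∥≡0⇒z≡0 : ∀ z → ∥ z ∥ ≡ 0 → z ≡ 0ᵍ
∥z∥≡0⇒z≡0 (+ zero +i + zero) refl = refl

-- If neither coordinate vanished, both squares would be at least 1 and the norm at least 2.
norm≡1⇒re≡0∨im≡0 : ∀ z → norm z ≡ 1ℤ → re z ≡ 0ℤ ⊎ im z ≡ 0ℤ
norm≡1⇒re≡0∨im≡0 z eq = on-axis z (ℤ.+-injective (trans (+∥z∥≡norm z) eq))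
  where
  on-axis : ∀ z → ∥ z ∥ ≡ 1 → re z ≡ 0ℤ ⊎ im z ≡ 0ℤ
  on-axis (+ zero          +i b)              _  = inj₁ refl
  on-axis (a               +i + zero)         _  = inj₂ refl
  on-axis (+ suc zero      +i + suc n)        ()
  on-axis (+ suc zero      +i -[1+ n ])       ()
  on-axis (+ suc (suc m)   +i b)              ()
  on-axis (-[1+ zero ]     +i + suc n)        ()
  on-axis (-[1+ zero ]     +i -[1+ n ])       ()
  on-axis (-[1+ suc m ]    +i b)              ()

-- e witnesses (2 ∣ p - k N ∣)² ≤ N², that is, k is an integer nearest to p / N.
nearest : ∀ p n {N} .{{_ : NonZero n}} → + n ≡ N →
  ∃₂ λ k (e : ℕ) → + 4 * ((p - k * N) * (p - k * N)) + + e ≡ N * N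
nearest p n@(suc _) refl = k , r ℕ.* s , (begin
  + 4 * ((p - k * N) * (p - k * N)) + + (r ℕ.* s)
    ≡⟨ cong₂ _+_ (double p k N) (trans (ℤ.pos-* r s) (cong (+ r *_) S≡)) ⟩
  square (+ 2 * p + N) + + r * (+ 2 * N - + r)
    ≡⟨ cong (λ t → square t + + r * (+ 2 * N - + r)) T≡ ⟩
  square (+ r + k * (+ 2 * N)) + + r * (+ 2 * N - + r)
    ≡⟨ collect (+ r) k N ⟩
  N * N ∎)
  where
  open ≡-Reasoning
  N = + n
  M = 2 ℕ.* n
  T = + 2 * p + N
  -- The floor of (2 p + N) / (2 N) is p / N rounded. The remainder satisfies 2 (p - k N) = r - N,
  -- so the defect is N² - (r - N)² = r (2 N - r), which is `r ℕ.* s` and is not negative because r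
  -- < 2 N.
  k = T /ℕ M
  r = T %ℕ M
  s = M ℕ.∸ r
  square : ℤ → ℤ
  square t = (t - k * (+ 2 * N) - N) * (t - k * (+ 2 * N) - N)
  M≡ : + M ≡ + 2 * N
  M≡ = ℤ.pos-* 2 n
  T≡ : T ≡ + r + k * (+ 2 * N)
  T≡ = trans (a≡a%ℕn+[a/ℕn]*n T M) (cong (λ m → + r + k * m) M≡)
  cancel : ∀ i j → i ≡ j + i - j
  cancel = solve-∀
  S≡ : + s ≡ + 2 * N - + r
  S≡ = trans (cancel (+ s) (+ r)) (cong (_- + r) (trans (sym (ℤ.pos-+ r s))
    (trans (cong +_ (ℕ.m+[n∸m]≡n (ℕ.<⇒≤ (n%ℕd<d T M)))) M≡)))
  double : ∀ p k N → + 4 * ((p - k * N) * (p - k * N))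
    ≡ (+ 2 * p + N - k * (+ 2 * N) - N) * (+ 2 * p + N - k * (+ 2 * N) - N)
  double = solve-∀
  collect : ∀ r k N →
    (r + k * (+ 2 * N) - k * (+ 2 * N) - N) * (r + k * (+ 2 * N) - k * (+ 2 * N) - N)
    + r * (+ 2 * N - r) ≡ N * N
  collect = solve-∀

4mn≤2n²⇒m<n : ∀ m n .{{_ : NonZero n}} → 4 ℕ.* (m ℕ.* n) ℕ.≤ 2 ℕ.* (n ℕ.* n) → m ℕ.< n
4mn≤2n²⇒m<n m n le = ℕ.≰⇒> λ n≤m → ℕ.<⇒≱
  (ℕ.*-monoˡ-< (n ℕ.* n) {{ℕ.m*n≢0 n n}} {2} {4} (ℕ.s≤s (ℕ.s≤s (ℕ.s≤s ℕ.z≤n))))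
  (ℕ.≤-trans (ℕ.*-monoʳ-≤ 4 (ℕ.*-monoˡ-≤ n n≤m)) le)

-- Rounding both coordinates of the exact quotient leaves an error of at most 1/2 in each. Adding
-- the two estimates gives 4 N(r) N(w) ≤ 2 N(w)².
euclid : ∀ z w .{{_ : NonZero ∥ w ∥}} → ∃₂ λ q r → z ≡ q ⊠ w ⊞ r × ∥ r ∥ ℕ.< ∥ w ∥
euclid z@(a +i b) w@(c +i d) =
  -- The two numerators are the real and imaginary parts of z times the conjugate of w; the common
  -- denominator is N(w).
  let (k₁ , e₁ , eq₁) = nearest (a * c + b * d) ∥ w ∥ (+∥z∥≡norm w)
      (k₂ , e₂ , eq₂) = nearest (b * c - a * d) ∥ w ∥ (+∥z∥≡norm w)
  in divide k₁ k₂ e₁ e₂ eq₁ eq₂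
  where
  divide : ∀ k₁ k₂ (e₁ e₂ : ℕ) →
    + 4 * ((a * c + b * d - k₁ * norm w) * (a * c + b * d - k₁ * norm w)) + + e₁ ≡ norm w * norm w →
    + 4 * ((b * c - a * d - k₂ * norm w) * (b * c - a * d - k₂ * norm w)) + + e₂ ≡ norm w * norm w →
    ∃₂ λ q r → z ≡ q ⊠ w ⊞ r × ∥ r ∥ ℕ.< ∥ w ∥
  divide k₁ k₂ e₁ e₂ eq₁ eq₂ = q , r , z≡ , 4mn≤2n²⇒m<n ∥ r ∥ ∥ w ∥ bound
    where
    open ≡-Reasoning
    q r : ℤ[i]
    q = k₁ +i k₂
    r = (a - (k₁ * c - k₂ * d)) +i (b - (k₁ * d + k₂ * c))
    restore : ∀ x y → x ≡ y + (x - y)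
    restore = solve-∀
    z≡ : z ≡ q ⊠ w ⊞ r
    z≡ = cong₂ _+i_ (restore a (k₁ * c - k₂ * d)) (restore b (k₁ * d + k₂ * c))
    expand : ∀ a b c d k l e f →
      + 4 * (((a - (k * c - l * d)) * (a - (k * c - l * d))
              + (b - (k * d + l * c)) * (b - (k * d + l * c))) * (c * c + d * d)) + (e + f)
      ≡ (+ 4 * ((a * c + b * d - k * (c * c + d * d)) * (a * c + b * d - k * (c * c + d * d))) + e)
      + (+ 4 * ((b * c - a * d - l * (c * c + d * d)) * (b * c - a * d - l * (c * c + d * d))) + f)
    expand = solve-∀
    twice : ∀ n → n * n + n * n ≡ + 2 * (n * n)
    twice = solve-∀
    total : + 4 * (norm r * norm w) + (+ e₁ + + e₂) ≡ + 2 * (norm w * norm w)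
    total = trans (expand a b c d k₁ k₂ (+ e₁) (+ e₂)) (trans (cong₂ _+_ eq₁ eq₂) (twice (norm w)))
    total-ℕ : 4 ℕ.* (∥ r ∥ ℕ.* ∥ w ∥) ℕ.+ (e₁ ℕ.+ e₂) ≡ 2 ℕ.* (∥ w ∥ ℕ.* ∥ w ∥)
    total-ℕ = ℤ.+-injective (begin
      + (4 ℕ.* (∥ r ∥ ℕ.* ∥ w ∥) ℕ.+ (e₁ ℕ.+ e₂))
        ≡⟨ ℤ.pos-+ (4 ℕ.* (∥ r ∥ ℕ.* ∥ w ∥)) (e₁ ℕ.+ e₂) ⟩
      + (4 ℕ.* (∥ r ∥ ℕ.* ∥ w ∥)) + + (e₁ ℕ.+ e₂)
        ≡⟨ cong₂ _+_ (trans (ℤ.pos-* 4 (∥ r ∥ ℕ.* ∥ w ∥)) (cong (+ 4 *_) (ℤ.pos-* ∥ r ∥ ∥ w ∥)))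
                     (ℤ.pos-+ e₁ e₂) ⟩
      + 4 * (+ ∥ r ∥ * + ∥ w ∥) + (+ e₁ + + e₂)
        ≡⟨ cong₂ (λ m n → + 4 * (m * n) + (+ e₁ + + e₂)) (+∥z∥≡norm r) (+∥z∥≡norm w) ⟩
      + 4 * (norm r * norm w) + (+ e₁ + + e₂)
        ≡⟨ total ⟩
      + 2 * (norm w * norm w)
        ≡⟨ cong (λ n → + 2 * (n * n)) (+∥z∥≡norm w) ⟨
      + 2 * (+ ∥ w ∥ * + ∥ w ∥)
        ≡⟨ trans (ℤ.pos-* 2 (∥ w ∥ ℕ.* ∥ w ∥)) (cong (+ 2 *_) (ℤ.pos-* ∥ w ∥ ∥ w ∥)) ⟨
      + (2 ℕ.* (∥ w ∥ ℕ.* ∥ w ∥)) ∎)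
    bound : 4 ℕ.* (∥ r ∥ ℕ.* ∥ w ∥) ℕ.≤ 2 ℕ.* (∥ w ∥ ℕ.* ∥ w ∥)
    bound = subst (4 ℕ.* (∥ r ∥ ℕ.* ∥ w ∥) ℕ.≤_) total-ℕ (ℕ.m≤m+n _ (e₁ ℕ.+ e₂))

-- Greatest common divisors in ℤ[i] and coprime factors of a power.

Bezout : ℤ[i] → ℤ[i] → Set
Bezout z w = ∃ λ d → ∃₂ λ s t → d ≡ s ⊠ z ⊞ t ⊠ w × d ∣ᵍ z × d ∣ᵍ w

bezout-zero : ∀ z → Bezout z 0ᵍ
bezout-zero z =
  z , 1ᵍ , 0ᵍ , solve 1 (λ z → z := con 1 :* z :+ con 0 :* con 0) refl z , 𝔾.∣-refl , z 𝔾.∣0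
  where
  open import Algebra.Solver.Ring.NaturalCoefficients.Default ℤ[i]-commutativeSemiring

bezout-step : ∀ {w r} q → Bezout w r → Bezout (q ⊠ w ⊞ r) w
bezout-step {w} {r} q (d , s , t , d≡ , (x , xd≡w) , (y , yd≡r)) =
  d , t , neg t ⊠ q ⊞ s , trans d≡ (begin
    s ⊠ w ⊞ t ⊠ r
      ≡⟨ solve 5 (λ s t q w r →
           s :* w :+ t :* r := s :* w :+ t :* r :+ con 0 :* (q :* w)) refl s t q w r ⟩
    s ⊠ w ⊞ t ⊠ r ⊞ 0ᵍ ⊠ (q ⊠ w)
      -- The semiring solver knows no negation. So 0 is written as `t ⊞ neg t`, after which `neg t`
      -- is treated as one more variable.
      ≡⟨ cong (λ z → s ⊠ w ⊞ t ⊠ r ⊞ z ⊠ (q ⊠ w)) (+-neg t) ⟨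
    s ⊠ w ⊞ t ⊠ r ⊞ (t ⊞ neg t) ⊠ (q ⊠ w)
      ≡⟨ solve 6 (λ s t n q w r →
           s :* w :+ t :* r :+ (t :+ n) :* (q :* w)
           := t :* (q :* w :+ r) :+ (n :* q :+ s) :* w) refl s t (neg t) q w r ⟩
    t ⊠ (q ⊠ w ⊞ r) ⊞ (neg t ⊠ q ⊞ s) ⊠ w ∎)
  , (q ⊠ x ⊞ y , trans
      (solve 4 (λ q x y d → (q :* x :+ y) :* d := q :* (x :* d) :+ y :* d) refl q x y d)
      (cong₂ (λ w r → q ⊠ w ⊞ r) xd≡w yd≡r))
  , (x , xd≡w)
  where
  open ≡-Reasoning
  open import Algebra.Solver.Ring.NaturalCoefficients.Default ℤ[i]-commutativeSemiring
  neg : ℤ[i] → ℤ[i]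
  neg (a +i b) = (- a) +i (- b)
  +-neg : ∀ z → z ⊞ neg z ≡ 0ᵍ
  +-neg (a +i b) = cong₂ _+i_ (ℤ.+-inverseʳ a) (ℤ.+-inverseʳ b)

bezout : ∀ z w → Bezout z w
bezout z w = go z w (<-wellFounded ∥ w ∥)
  where
  go : ∀ z w → Acc ℕ._<_ ∥ w ∥ → Bezout z w
  go z w (acc rec) with ∥ w ∥ ℕ.≟ 0
  ... | yes ∥w∥≡0 = subst (Bezout z) (sym (∥z∥≡0⇒z≡0 w ∥w∥≡0)) (bezout-zero z)
  ... | no ∥w∥≢0 = let (q , r , z≡ , r<w) = euclid z w {{ℕ.≢-nonZero ∥w∥≢0}} in
    subst (λ z → Bezout z w) (sym z≡) (bezout-step q (go w r (rec r<w)))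

norm*norm≡1⇒norm≡1 : ∀ z w → norm z * norm w ≡ 1ℤ → norm z ≡ 1ℤ
norm*norm≡1⇒norm≡1 z w eq = trans (sym (+∥z∥≡norm z)) (cong +_ (ℕ.m*n≡1⇒m≡1 ∥ z ∥ ∥ w ∥
  (ℤ.+-injective (trans (ℤ.pos-* ∥ z ∥ ∥ w ∥) (trans (cong₂ _*_ (+∥z∥≡norm z) (+∥z∥≡norm w)) eq)))))

-- Taking norms gives N(r) N(s) N(u) = N(u). After N(u) is cancelled, N(r) is a natural number
-- dividing 1.
associates⇒norm≡1 : ∀ {u e} r s → norm u ≢ 0ℤ → r ⊠ e ≡ u → s ⊠ u ≡ e → norm r ≡ 1ℤ
associates⇒norm≡1 {u} {e} r s Nu≢0 re≡u su≡e = norm*norm≡1⇒norm≡1 r s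
  (ℤ.*-cancelʳ-≡ (norm r * norm s) 1ℤ (norm u) {{ℤ.≢-nonZero Nu≢0}} (begin
    norm r * norm s * norm u    ≡⟨ ℤ.*-assoc (norm r) (norm s) (norm u) ⟩
    norm r * (norm s * norm u)  ≡⟨ cong (norm r *_) (norm-⊠ s u) ⟨
    norm r * norm (s ⊠ u)       ≡⟨ cong (λ z → norm r * norm z) su≡e ⟩
    norm r * norm e             ≡⟨ norm-⊠ r e ⟨
    norm (r ⊠ e)                ≡⟨ cong norm re≡u ⟩
    norm u                      ≡⟨ ℤ.*-identityˡ (norm u) ⟨
    1ℤ * norm u                 ∎))
  where open ≡-Reasoning

-- Take `d` to be a greatest common divisor of `u` and `c`: then `u` and `d ^ᵍ n` divide each other,
-- so they differ by a unit. This avoids factorisation into primes.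
coprime-factor : ∀ {u v} c n → norm u ≢ 0ℤ → Coprime u v → u ⊠ v ≡ c ^ᵍ n →
  ∃₂ λ d r → u ≡ r ⊠ d ^ᵍ n × norm r ≡ 1ℤ
coprime-factor {u} c n Nu≢0 cop uv≡cⁿ =
  let (d , s , t , d≡ , d∣u , d∣c) = bezout u c
      ((r , rdⁿ≡u) , (r′ , r′u≡dⁿ)) = 𝔾.coprime-factor-^ s t n cop uv≡cⁿ d≡ d∣u d∣c
  in d , r , sym rdⁿ≡u , associates⇒norm≡1 r r′ Nu≢0 rdⁿ≡u r′u≡dⁿ

-- Units and parity in ℤ.

Even Odd : ℤ → Set
Even i = ∃ λ k → i ≡ + 2 * k
Odd  i = ∃ λ k → i ≡ + 2 * k + 1ℤ

i*j≡1⇒∣i∣≡1 : ∀ i j → i * j ≡ 1ℤ → ∣ i ∣ ≡ 1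
i*j≡1⇒∣i∣≡1 i j eq = ℕ.m*n≡1⇒m≡1 ∣ i ∣ ∣ j ∣ (trans (sym (ℤ.abs-* i j)) (cong ∣_∣ eq))

i*j≡1⇒i≡±1 : ∀ i j → i * j ≡ 1ℤ → i ≡ 1ℤ ⊎ i ≡ -1ℤ
i*j≡1⇒i≡±1 i j eq with i | i*j≡1⇒∣i∣≡1 i j eq
... | + 1        | refl = inj₁ refl
... | -[1+ 0 ]   | refl = inj₂ refl

i*j≡1⇒i*i≡1 : ∀ i j → i * j ≡ 1ℤ → i * i ≡ 1ℤ
i*j≡1⇒i*i≡1 i j eq with i*j≡1⇒i≡±1 i j eq
... | inj₁ refl = refl
... | inj₂ refl = refl

even∧odd⇒⊥ : ∀ {i} → Even i → Odd i → ⊥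
even∧odd⇒⊥ (k , refl) (l , eq) = contradiction (i*j≡1⇒∣i∣≡1 (+ 2) (k - l) (begin
  + 2 * (k - l)            ≡⟨ distrib k l ⟩
  + 2 * k - + 2 * l        ≡⟨ cong (_- + 2 * l) eq ⟩
  + 2 * l + 1ℤ - + 2 * l   ≡⟨ cancel (+ 2 * l) ⟩
  1ℤ                       ∎)) λ ()
  where
  open ≡-Reasoning
  distrib : ∀ k l → + 2 * (k - l) ≡ + 2 * k - + 2 * l
  distrib = solve-∀
  cancel : ∀ i → i + 1ℤ - i ≡ 1ℤ
  cancel = solve-∀

odd-1 : Odd 1ℤ
odd-1 = 0ℤ , refl

parity : ∀ i → Even i ⊎ Odd i
parity i with i %ℕ 2 | n%ℕd<d i 2 | a≡a%ℕn+[a/ℕn]*n i 2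
... | 0 | _ | eq = inj₁ (i /ℕ 2 , trans eq (comm (i /ℕ 2)))
  where
  comm : ∀ k → + 0 + k * + 2 ≡ + 2 * k
  comm = solve-∀
... | 1 | _ | eq = inj₂ (i /ℕ 2 , trans eq (comm (i /ℕ 2)))
  where
  comm : ∀ k → + 1 + k * + 2 ≡ + 2 * k + 1ℤ
  comm = solve-∀
... | suc (suc _) | ℕ.s≤s (ℕ.s≤s ()) | _

even-*ˡ : ∀ {i} j → Even i → Even (i * j)
even-*ˡ j (k , refl) = k * j , ℤ.*-assoc (+ 2) k j

even-*ʳ : ∀ i {j} → Even j → Even (i * j)
even-*ʳ i {j} ev = subst Even (ℤ.*-comm j i) (even-*ˡ i ev)

odd-* : ∀ {i j} → Odd i → Odd j → Odd (i * j)
odd-* (k , refl) (l , refl) = + 2 * k * l + k + l , expand k l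
  where
  expand : ∀ k l → (+ 2 * k + 1ℤ) * (+ 2 * l + 1ℤ) ≡ + 2 * (+ 2 * k * l + k + l) + 1ℤ
  expand = solve-∀

odd-^ : ∀ {i} n → Odd i → Odd (i ^ n)
odd-^ zero    _  = odd-1
odd-^ (suc n) od = odd-* od (odd-^ n od)

even+even : ∀ {i j} → Even i → Even j → Even (i + j)
even+even (k , refl) (l , refl) = k + l , sym (ℤ.*-distribˡ-+ (+ 2) k l)

odd+odd : ∀ {i j} → Odd i → Odd j → Even (i + j)
odd+odd (k , refl) (l , refl) = k + l + 1ℤ , expand k l
  where
  expand : ∀ k l → (+ 2 * k + 1ℤ) + (+ 2 * l + 1ℤ) ≡ + 2 * (k + l + 1ℤ)
  expand = solve-∀

even+1 : ∀ {i} → Even i → Odd (i + 1ℤ)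
even+1 (k , refl) = k , refl

-- Powers of ± 1 + β i for even β, seen 2-adically.

halve : ∀ n → ∃ λ k → n ≡ k ℕ.* 2 ⊎ n ≡ suc (k ℕ.* 2)
halve zero    = 0 , inj₁ refl
halve (suc n) with halve n
... | k , inj₁ eq = k , inj₂ (cong suc eq)
... | k , inj₂ eq = suc k , inj₁ (cong suc eq)

-- The powers of d², for d = ± 1 + β i and γ = ± β, all have this shape.
twist : ℤ → ℤ → ℤ → ℤ[i]
twist γ A B = (1ℤ - γ * γ * A) +i (+ 2 * γ * B)

twist-⊠ : ∀ γ A B C D → twist γ A B ⊠ twist γ C D ≡
  twist γ (A + C - γ * γ * A * C + + 4 * B * D) (B * (1ℤ - γ * γ * C) + D * (1ℤ - γ * γ * A))
twist-⊠ γ A B C D = cong₂ _+i_ (re-⊠ γ A B C D) (im-⊠ γ A B C D)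
  where
  re-⊠ : ∀ γ A B C D →
    (1ℤ - γ * γ * A) * (1ℤ - γ * γ * C) - (+ 2 * γ * B) * (+ 2 * γ * D)
    ≡ 1ℤ - γ * γ * (A + C - γ * γ * A * C + + 4 * B * D)
  re-⊠ = solve-∀
  im-⊠ : ∀ γ A B C D →
    (1ℤ - γ * γ * A) * (+ 2 * γ * D) + (+ 2 * γ * B) * (1ℤ - γ * γ * C)
    ≡ + 2 * γ * (B * (1ℤ - γ * γ * C) + D * (1ℤ - γ * γ * A))
  im-⊠ = solve-∀

-- A has exactly as many factors 2 as the exponent of the power, and B at least
-- as many, so that A + 2 B ≠ 0.
Unbalanced : ℤ → ℤ[i] → Set
Unbalanced γ z = ∃ λ s → ∃₂ λ a b →
  z ≡ twist γ ((+ 2) ^ s * (+ 2 * a + 1ℤ)) ((+ 2) ^ s * b)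

-- Squaring sends A to 2 A - γ² A² + 4 B² and B to 2 B (1 - γ² A). With A = p o, B = p b and γ = 2
-- δ, the new A is 2 p (o - 2 δ² p o² + 2 p b²), whose bracket is odd. So A gains exactly one factor
-- 2 and B at least one.
unbalanced-square : ∀ {γ z} → Even γ → Unbalanced γ z → Unbalanced γ (z ⊠ z)
unbalanced-square {γ} (δ , refl) (s , a , b , refl) =
  suc s , a - δ * δ * p * o * o + p * b * b , b * (1ℤ - γ * γ * (p * o)) ,
  trans (twist-⊠ γ (p * o) (p * b) (p * o) (p * b))
    (cong₂ (twist γ) (double-A δ p a b) (double-B γ (p * o) p b))
  where
  p = (+ 2) ^ s
  o = + 2 * a + 1ℤ
  double-A : ∀ δ p a b →
    p * (+ 2 * a + 1ℤ) + p * (+ 2 * a + 1ℤ)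
    - + 2 * δ * (+ 2 * δ) * (p * (+ 2 * a + 1ℤ)) * (p * (+ 2 * a + 1ℤ)) + + 4 * (p * b) * (p * b)
    ≡ + 2 * p * (+ 2 * (a - δ * δ * p * (+ 2 * a + 1ℤ) * (+ 2 * a + 1ℤ) + p * b * b) + 1ℤ)
  double-A = solve-∀
  double-B : ∀ γ A p b →
    p * b * (1ℤ - γ * γ * A) + p * b * (1ℤ - γ * γ * A)
    ≡ + 2 * p * (b * (1ℤ - γ * γ * A))
  double-B = solve-∀

-- Multiplication by `twist γ 1ℤ 1ℤ` sends A to 1 + A - γ² A + 4 B, which flips its parity because γ
-- is even. Two such steps restore it, starting from A = 1.
twist-odd-^ : ∀ {γ} → Even γ → ∀ n → ∃₂ λ A B →
  twist γ 1ℤ 1ℤ ^ᵍ suc (n ℕ.* 2) ≡ twist γ A B × Odd A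
twist-odd-^ {γ} _ zero = 1ℤ , 1ℤ , 𝔾.*-identityʳ (twist γ 1ℤ 1ℤ) , odd-1
twist-odd-^ {γ} ev (suc n) = let (A , B , eq , od) = twist-odd-^ ev n in
  nextA (nextA A B) (nextB A B) , nextB (nextA A B) (nextB A B) ,
  trans (cong (λ z → G ⊠ (G ⊠ z)) eq)
    (trans (cong (G ⊠_) (twist-⊠ γ 1ℤ 1ℤ A B)) (twist-⊠ γ 1ℤ 1ℤ (nextA A B) (nextB A B))) ,
  even⇒odd ev (nextB A B) (odd⇒even ev B od)
  where
  G = twist γ 1ℤ 1ℤ
  nextA nextB : ℤ → ℤ → ℤ
  nextA A B = 1ℤ + A - γ * γ * 1ℤ * A + + 4 * 1ℤ * B
  nextB A B = 1ℤ * (1ℤ - γ * γ * A) + B * (1ℤ - γ * γ * 1ℤ)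
  odd⇒even : ∀ {γ A} → Even γ → ∀ B → Odd A → Even (1ℤ + A - γ * γ * 1ℤ * A + + 4 * 1ℤ * B)
  odd⇒even (δ , refl) B (a , refl) = 1ℤ + a - + 2 * δ * δ * (+ 2 * a + 1ℤ) + + 2 * B , expand δ a B
    where
    expand : ∀ δ a B →
      1ℤ + (+ 2 * a + 1ℤ) - + 2 * δ * (+ 2 * δ) * 1ℤ * (+ 2 * a + 1ℤ) + + 4 * 1ℤ * B
      ≡ + 2 * (1ℤ + a - + 2 * δ * δ * (+ 2 * a + 1ℤ) + + 2 * B)
    expand = solve-∀
  even⇒odd : ∀ {γ A} → Even γ → ∀ B → Even A → Odd (1ℤ + A - γ * γ * 1ℤ * A + + 4 * 1ℤ * B)
  even⇒odd (δ , refl) B (a , refl) = a - + 4 * δ * δ * a + + 2 * B , expand δ a B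
    where
    expand : ∀ δ a B →
      1ℤ + + 2 * a - + 2 * δ * (+ 2 * δ) * 1ℤ * (+ 2 * a) + + 4 * 1ℤ * B
      ≡ + 2 * (a - + 4 * δ * δ * a + + 2 * B) + 1ℤ
    expand = solve-∀

-- Strong induction that halves the exponent: an odd exponent gives an odd A, so `s` is 0, and each
-- doubling of the exponent is a squaring.
twist-^-unbalanced : ∀ {γ} → Even γ → ∀ n .{{_ : NonZero n}} → Unbalanced γ (twist γ 1ℤ 1ℤ ^ᵍ n)
twist-^-unbalanced {γ} ev n = go n (<-wellFounded n)
  where
  G = twist γ 1ℤ 1ℤ
  go : ∀ n .{{_ : NonZero n}} → Acc ℕ._<_ n → Unbalanced γ (G ^ᵍ n)
  go n (acc rec) with halve n
  ... | k , inj₂ refl = let (A , b , eq , (a , A≡)) = twist-odd-^ ev k in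
    0 , a , b , trans eq (cong₂ (twist γ)
      (trans A≡ (sym (ℤ.*-identityˡ (+ 2 * a + 1ℤ)))) (sym (ℤ.*-identityˡ b)))
  ... | suc k , inj₁ refl = subst (Unbalanced γ) square
      (unbalanced-square ev (go (suc k) (rec (ℕ.m<m*n (suc k) 2 (ℕ.s≤s (ℕ.s≤s ℕ.z≤n))))))
    where
    square : G ^ᵍ suc k ⊠ G ^ᵍ suc k ≡ G ^ᵍ (suc k ℕ.* 2)
    square = trans (sym (𝔾.^-homo-* G (suc k) (suc k)))
      (cong (G ^ᵍ_) (trans (cong (suc k ℕ.+_) (sym (ℕ.+-identityʳ (suc k)))) (ℕ.*-comm 2 (suc k))))

2^s*odd≢0 : ∀ s {i} → Odd i → (+ 2) ^ s * i ≢ 0ℤ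
2^s*odd≢0 s od eq with ℤ.i*j≡0⇒i≡0∨j≡0 ((+ 2) ^ s) eq
... | inj₁ 2^s≡0 = contradiction (ℤ.i^n≡0⇒i≡0 (+ 2) s 2^s≡0) λ ()
... | inj₂ refl  = even∧odd⇒⊥ (0ℤ , refl) od

-- For d = α + β i the square d² is `twist γ 1ℤ 1ℤ` with γ = α β. If its n-th power is
-- `twist γ A B`, multiplying by d once more gives the real part α (1 - β² (A + 2 B)), so K = A + 2
-- B. This is a power of 2 times an odd number. Squaring removes the sign α.
re-[±1+βi]^[1+2n] : ∀ {α β} → α ≡ 1ℤ ⊎ α ≡ -1ℤ → Even β → ∀ n .{{_ : NonZero n}} →
  ∃ λ K → K ≢ 0ℤ × (let z = (α +i β) ^ᵍ suc (n ℕ.* 2) in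
    re z * re z ≡ (1ℤ - β * β * K) * (1ℤ - β * β * K))
re-[±1+βi]^[1+2n] {α} {β} α≡±1 ev n = K-for α≡±1
  where
  d = α +i β
  square-^ : d ^ᵍ (n ℕ.* 2) ≡ (d ^ᵍ 2) ^ᵍ n
  square-^ = trans (cong (d ^ᵍ_) (ℕ.*-comm n 2)) (sym (𝔾.^-assocʳ d 2 n))
  Sum : ℕ → ℤ → ℤ → ℤ
  Sum s a b = (+ 2) ^ s * (+ 2 * a + 1ℤ) + + 2 * ((+ 2) ^ s * b)
  sum≢0 : ∀ s a b → Sum s a b ≢ 0ℤ
  sum≢0 s a b eq = 2^s*odd≢0 s (a + b , refl) (trans (factor ((+ 2) ^ s) a b) eq)
    where
    factor : ∀ p a b → p * (+ 2 * (a + b) + 1ℤ) ≡ p * (+ 2 * a + 1ℤ) + + 2 * (p * b)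
    factor = solve-∀
  K-for : α ≡ 1ℤ ⊎ α ≡ -1ℤ →
    ∃ λ K → K ≢ 0ℤ × (let z = d ^ᵍ suc (n ℕ.* 2) in
      re z * re z ≡ (1ℤ - β * β * K) * (1ℤ - β * β * K))
  K-for (inj₁ refl) = let (s , a , b , eq) = twist-^-unbalanced ev n in
    Sum s a b , sum≢0 s a b ,
    trans (cong (λ z → re (d ⊠ z) * re (d ⊠ z)) (trans square-^ (trans (cong (_^ᵍ n) d²≡) eq)))
      (expand β _ _)
    where
    d²-re : ∀ β → 1ℤ * (1ℤ * 1ℤ - β * 0ℤ) - β * (1ℤ * 0ℤ + β * 1ℤ) ≡ 1ℤ - β * β * 1ℤ
    d²-re = solve-∀
    d²-im : ∀ β → 1ℤ * (1ℤ * 0ℤ + β * 1ℤ) + β * (1ℤ * 1ℤ - β * 0ℤ) ≡ + 2 * β * 1ℤ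
    d²-im = solve-∀
    d²≡ : d ^ᵍ 2 ≡ twist β 1ℤ 1ℤ
    d²≡ = cong₂ _+i_ (d²-re β) (d²-im β)
    expand : ∀ β A B →
      (1ℤ * (1ℤ - β * β * A) - β * (+ 2 * β * B)) * (1ℤ * (1ℤ - β * β * A) - β * (+ 2 * β * B))
      ≡ (1ℤ - β * β * (A + + 2 * B)) * (1ℤ - β * β * (A + + 2 * B))
    expand = solve-∀
  K-for (inj₂ refl) = let (s , a , b , eq) = twist-^-unbalanced (neg-even ev) n in
    Sum s a b , sum≢0 s a b ,
    trans (cong (λ z → re (d ⊠ z) * re (d ⊠ z)) (trans square-^ (trans (cong (_^ᵍ n) d²≡) eq)))
      (expand β _ _)
    where
    neg-even : Even β → Even (- β)
    neg-even (k , refl) = - k , ℤ.neg-distribʳ-* (+ 2) k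
    d²-re : ∀ β → -1ℤ * (-1ℤ * 1ℤ - β * 0ℤ) - β * (-1ℤ * 0ℤ + β * 1ℤ) ≡ 1ℤ - (- β) * (- β) * 1ℤ
    d²-re = solve-∀
    d²-im : ∀ β → -1ℤ * (-1ℤ * 0ℤ + β * 1ℤ) + β * (-1ℤ * 1ℤ - β * 0ℤ) ≡ + 2 * (- β) * 1ℤ
    d²-im = solve-∀
    d²≡ : d ^ᵍ 2 ≡ twist (- β) 1ℤ 1ℤ
    d²≡ = cong₂ _+i_ (d²-re β) (d²-im β)
    expand : ∀ β A B →
      (-1ℤ * (1ℤ - (- β) * (- β) * A) - β * (+ 2 * (- β) * B))
      * (-1ℤ * (1ℤ - (- β) * (- β) * A) - β * (+ 2 * (- β) * B))
      ≡ (1ℤ - β * β * (A + + 2 * B)) * (1ℤ - β * β * (A + + 2 * B))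
    expand = solve-∀

-- With t = β² K, the equation (1 - t)² = 1 reads t (t - 2) = 0. Since 4 divides t, t = 2 is
-- impossible; and t = 0 with K ≠ 0 leaves β = 0.
re²≡1⇒β≡0 : ∀ {α β} → α ≡ 1ℤ ⊎ α ≡ -1ℤ → Even β → ∀ n .{{_ : NonZero n}} →
  (let z = (α +i β) ^ᵍ suc (n ℕ.* 2) in re z * re z ≡ 1ℤ) → β ≡ 0ℤ
re²≡1⇒β≡0 {α} {β} α≡±1 ev@(δ , β≡2δ) n re²≡1 =
  let (K , K≢0 , eq) = re-[±1+βi]^[1+2n] α≡±1 ev n
      product : (β * β * K) * (β * β * K - + 2) ≡ 0ℤ
      product = trans (expand (β * β * K)) (cong (_- 1ℤ) (trans (sym eq) re²≡1))
  in [ (λ β²K≡0 → [ (λ β²≡0 → [ id , id ]′ (ℤ.i*j≡0⇒i≡0∨j≡0 β β²≡0))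
                  , (λ K≡0 → contradiction K≡0 K≢0) ]′ (ℤ.i*j≡0⇒i≡0∨j≡0 (β * β) β²K≡0))
     , (λ β²K-2≡0 → contradiction (ℤ.i-j≡0⇒i≡j _ (+ 2) β²K-2≡0) (β²K≢2 K)) ]′
     (ℤ.i*j≡0⇒i≡0∨j≡0 (β * β * K) product)
  where
  expand : ∀ t → t * (t - + 2) ≡ (1ℤ - t) * (1ℤ - t) - 1ℤ
  expand = solve-∀
  quarter : ∀ δ K → + 2 * (+ 2 * (δ * δ * K)) ≡ + 2 * δ * (+ 2 * δ) * K
  quarter = solve-∀
  β²K≢2 : ∀ K → β * β * K ≢ + 2
  β²K≢2 K eq = even∧odd⇒⊥ (δ * δ * K , sym (ℤ.*-cancelˡ-≡ (+ 2) _ 1ℤ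
    (trans (quarter δ K) (trans (cong (λ β → β * β * K) (sym β≡2δ)) eq)))) odd-1

-- Lebesgue's theorem.

-- In an odd power, each binomial term of the real part has an odd power of α, and each term of the
-- imaginary part an odd power of β.
odd-^-multiple : ∀ α β n → ∃₂ λ A B → (α +i β) ^ᵍ suc (n ℕ.* 2) ≡ (α * A) +i (β * B)
odd-^-multiple α β zero = 1ℤ , 1ℤ , trans (𝔾.*-identityʳ (α +i β))
  (cong₂ _+i_ (sym (ℤ.*-identityʳ α)) (sym (ℤ.*-identityʳ β)))
odd-^-multiple α β (suc n) with odd-^-multiple α β n
... | A , B , eq = _ , _ , trans (cong (λ z → (α +i β) ⊠ ((α +i β) ⊠ z)) eq)
    (cong₂ _+i_ (step-re α β A B) (step-im α β A B))
  where
  step-re : ∀ α β A B →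
    α * (α * (α * A) - β * (β * B)) - β * (α * (β * B) + β * (α * A))
    ≡ α * (α * (α * A) - + 2 * (β * (β * B)) - β * (β * A))
  step-re = solve-∀
  step-im : ∀ α β A B →
    α * (α * (β * B) + β * (α * A)) + β * (α * (α * A) - β * (β * B))
    ≡ β * (α * (α * B) + + 2 * (α * (α * A)) - β * (β * B))
  step-im = solve-∀

-- The factors of `(t - x) * (t + x) = 1` are both 1 or both -1, and their difference is 2 x.
x²+1≡t²⇒x≡0 : ∀ x t → x * x + 1ℤ ≡ t * t → x ≡ 0ℤ
x²+1≡t²⇒x≡0 x t eq = [ (λ ()) , id ]′ (ℤ.i*j≡0⇒i≡0∨j≡0 (+ 2) 2x≡0)
  where
  open ≡-Reasoning
  factor : ∀ x t → (t - x) * (t + x) ≡ t * t - x * x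
  factor = solve-∀
  cancel : ∀ x → x * x + 1ℤ - x * x ≡ 1ℤ
  cancel = solve-∀
  difference : ∀ x t → + 2 * x ≡ (t + x) - (t - x)
  difference = solve-∀
  product : (t - x) * (t + x) ≡ 1ℤ
  product = trans (factor x t) (trans (cong (_- x * x) (sym eq)) (cancel x))
  equal : ∀ i j → i * j ≡ 1ℤ → j ≡ i
  equal i j ij≡1 with i*j≡1⇒i≡±1 i j ij≡1
  ... | inj₁ refl = trans (sym (ℤ.*-identityˡ j)) ij≡1
  ... | inj₂ refl = ℤ.neg-injective (trans (sym (ℤ.-1*i≡-i j)) ij≡1)
  2x≡0 : + 2 * x ≡ 0ℤ
  2x≡0 = trans (difference x t) (ℤ.i≡j⇒i-j≡0 (equal (t - x) (t + x) product))

lebesgue-normalised : ∀ {x α β} r n .{{_ : NonZero n}} → norm r ≡ 1ℤ → Odd α → Even β →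
  x +i 1ℤ ≡ r ⊠ (α +i β) ^ᵍ suc (n ℕ.* 2) → x ≡ 0ℤ
lebesgue-normalised {x} {α} {β} r n norm-r od ev eq with odd-^-multiple α β n
... | A , B , z≡ = [ real-unit , imaginary-unit ]′ (norm≡1⇒re≡0∨im≡0 r norm-r)
  where
  open ≡-Reasoning
  m = suc (n ℕ.* 2)
  z = (α +i β) ^ᵍ m
  im≡1 : re r * im z + im r * re z ≡ 1ℤ
  im≡1 = sym (cong im eq)
  -- For real r, the imaginary part 1 equals `re r * im z`, which is even because β divides `im z`.
  imaginary-unit : im r ≡ 0ℤ → x ≡ 0ℤ
  imaginary-unit im-r≡0 = contradiction odd-1 (even∧odd⇒⊥ (subst Even (begin
    re r * im z                ≡⟨ ℤ.+-identityʳ _ ⟨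
    re r * im z + 0ℤ * re z    ≡⟨ cong (λ i → re r * im z + i * re z) im-r≡0 ⟨
    re r * im z + im r * re z  ≡⟨ im≡1 ⟩
    1ℤ                         ∎)
    (even-*ʳ (re r) (subst Even (sym (cong im z≡)) (even-*ˡ B ev)))))
  -- For r on the imaginary axis, 1 equals `im r * re z`. So `re z` is a unit, and with it its
  -- divisor α.
  real-unit : re r ≡ 0ℤ → x ≡ 0ℤ
  real-unit re-r≡0 = x²+1≡t²⇒x≡0 x 1ℤ norms
    where
    unit : re z * im r ≡ 1ℤ
    unit = begin
      re z * im r                ≡⟨ ℤ.*-comm (re z) (im r) ⟩
      im r * re z                ≡⟨ ℤ.+-identityˡ _ ⟨
      0ℤ * im z + im r * re z    ≡⟨ cong (λ i → i * im z + im r * re z) re-r≡0 ⟨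
      re r * im z + im r * re z  ≡⟨ im≡1 ⟩
      1ℤ                         ∎
    α≡±1 : α ≡ 1ℤ ⊎ α ≡ -1ℤ
    α≡±1 = i*j≡1⇒i≡±1 α (A * im r) (begin
      α * (A * im r)  ≡⟨ ℤ.*-assoc α A (im r) ⟨
      α * A * im r    ≡⟨ cong (λ z → re z * im r) z≡ ⟨
      re z * im r     ≡⟨ unit ⟩
      1ℤ              ∎)
    β≡0 : β ≡ 0ℤ
    β≡0 = re²≡1⇒β≡0 α≡±1 ev n (i*j≡1⇒i*i≡1 (re z) (im r) unit)
    norm-α : ∀ {α} → α ≡ 1ℤ ⊎ α ≡ -1ℤ → norm (α +i 0ℤ) ≡ 1ℤ
    norm-α (inj₁ refl) = refl
    norm-α (inj₂ refl) = refl
    norms : x * x + 1ℤ ≡ 1ℤ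
    norms = begin
      norm (x +i 1ℤ)                  ≡⟨ cong norm eq ⟩
      norm (r ⊠ z)                    ≡⟨ norm-⊠ r z ⟩
      norm r * norm z                 ≡⟨ cong₂ _*_ norm-r (norm-^ (α +i β) m) ⟩
      1ℤ * norm (α +i β) ^ m          ≡⟨ ℤ.*-identityˡ _ ⟩
      norm (α +i β) ^ m               ≡⟨ cong (λ β → norm (α +i β) ^ m) β≡0 ⟩
      norm (α +i 0ℤ) ^ m              ≡⟨ cong (_^ m) (norm-α α≡±1) ⟩
      1ℤ ^ m                          ≡⟨ ℤ.^-zeroˡ m ⟩
      1ℤ                              ∎

lebesgue : ∀ {x} r d m → 2 ℕ.≤ m → norm r ≡ 1ℤ → Even x → x +i 1ℤ ≡ r ⊠ d ^ᵍ m → x ≡ 0ℤ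
lebesgue {x} r d@(p +i q) m 2≤m norm-r ev eq = by-exponent (halve m)
  where
  open ≡-Reasoning
  norms : x * x + 1ℤ ≡ norm d ^ m
  norms = begin
    norm (x +i 1ℤ)       ≡⟨ cong norm eq ⟩
    norm (r ⊠ d ^ᵍ m)    ≡⟨ norm-⊠ r (d ^ᵍ m) ⟩
    norm r * norm (d ^ᵍ m)  ≡⟨ cong₂ _*_ norm-r (norm-^ d m) ⟩
    1ℤ * norm d ^ m      ≡⟨ ℤ.*-identityˡ _ ⟩
    norm d ^ m           ∎
  -- As x is even, x² + 1 = N(d)ᵐ is odd. This forces the coordinates of d to have opposite parity.
  norm-not-even : Even (norm d) → ⊥
  norm-not-even ev-d = even∧odd⇒⊥ (subst Even (sym norms) (even-^ m 2≤m)) (even+1 (even-*ˡ x ev))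
    where
    even-^ : ∀ m → 2 ℕ.≤ m → Even (norm d ^ m)
    even-^ (suc m) _ = even-*ˡ (norm d ^ m) ev-d
  by-exponent : (∃ λ k → m ≡ k ℕ.* 2 ⊎ m ≡ suc (k ℕ.* 2)) → x ≡ 0ℤ
  by-exponent (k , inj₁ refl) = x²+1≡t²⇒x≡0 x (norm d ^ k) (trans norms (begin
    norm d ^ (k ℕ.* 2)           ≡⟨ ℤ.^-*-assoc (norm d) k 2 ⟨
    (norm d ^ k) ^ 2             ≡⟨ cong (norm d ^ k *_) (ℤ.*-identityʳ (norm d ^ k)) ⟩
    norm d ^ k * norm d ^ k      ∎))
  by-exponent (zero , inj₂ refl) = contradiction 2≤m λ { (ℕ.s≤s ()) }
  by-exponent (k@(suc _) , inj₂ refl) with parity p | parity q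
  ... | inj₁ p-even | inj₁ q-even = contradiction
    (even+even (even-*ˡ p p-even) (even-*ˡ q q-even)) norm-not-even
  ... | inj₂ p-odd  | inj₂ q-odd  = contradiction
    (odd+odd (odd-* p-odd p-odd) (odd-* q-odd q-odd)) norm-not-even
  ... | inj₂ p-odd  | inj₁ q-even = lebesgue-normalised r k norm-r p-odd q-even eq
  ... | inj₁ (h , refl) | inj₂ q-odd =
    -- Write p + q i = i (q - p i): this moves the odd coordinate to the real place, and the factor
    -- iᵐ is absorbed into the unit.
    lebesgue-normalised (r ⊠ 𝕚 ^ᵍ m) k norm-r𝕚 q-odd (- h , ℤ.neg-distribʳ-* (+ 2) h) (begin
      x +i 1ℤ                       ≡⟨ eq ⟩
      r ⊠ d ^ᵍ m                    ≡⟨ cong (λ d → r ⊠ d ^ᵍ m)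
                                         (cong₂ _+i_ (rotate-re p q) (rotate-im p q)) ⟩
      r ⊠ (𝕚 ⊠ d′) ^ᵍ m             ≡⟨ cong (r ⊠_) (𝔾.^-distrib-* 𝕚 d′ m) ⟩
      r ⊠ (𝕚 ^ᵍ m ⊠ d′ ^ᵍ m)        ≡⟨ 𝔾.*-assoc r (𝕚 ^ᵍ m) (d′ ^ᵍ m) ⟨
      r ⊠ 𝕚 ^ᵍ m ⊠ d′ ^ᵍ m          ∎)
    where
    d′ = q +i (- p)
    rotate-re : ∀ p q → p ≡ 0ℤ * q - 1ℤ * (- p)
    rotate-re = solve-∀
    rotate-im : ∀ p q → q ≡ 0ℤ * (- p) + 1ℤ * q
    rotate-im = solve-∀
    norm-r𝕚 : norm (r ⊠ 𝕚 ^ᵍ m) ≡ 1ℤ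
    norm-r𝕚 = trans (norm-⊠ r (𝕚 ^ᵍ m))
      (cong₂ _*_ norm-r (trans (norm-^ 𝕚 m) (ℤ.^-zeroˡ m)))

-- Evaluation of the polynomials.

eval-⊕ : ∀ p q n → eval (p ⊕ q) n ≡ eval p n + eval q n
eval-⊕ []      q       n = sym (ℤ.+-identityˡ (eval q n))
eval-⊕ (a ∷ p) []      n = sym (ℤ.+-identityʳ (eval (a ∷ p) n))
eval-⊕ (a ∷ p) (b ∷ q) n = trans (cong (λ t → a + b + n * t) (eval-⊕ p q n))
  (rearrange a b n (eval p n) (eval q n))
  where
  rearrange : ∀ a b n s t → a + b + n * (s + t) ≡ a + n * s + (b + n * t)
  rearrange = solve-∀

eval-map-* : ∀ a q n → eval (map (a *_) q) n ≡ a * eval q n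
eval-map-* a []      n = sym (ℤ.*-zeroʳ a)
eval-map-* a (b ∷ q) n = trans (cong (λ t → a * b + n * t) (eval-map-* a q n))
  (rearrange a b n (eval q n))
  where
  rearrange : ∀ a b n t → a * b + n * (a * t) ≡ a * (b + n * t)
  rearrange = solve-∀

eval-⊗ : ∀ p q n → eval (p ⊗ q) n ≡ eval p n * eval q n
eval-⊗ []      q n = refl
eval-⊗ (a ∷ p) q n = trans (eval-⊕ (map (a *_) q) (0ℤ ∷ (p ⊗ q)) n)
  (trans (cong₂ (λ s t → s + (0ℤ + n * t)) (eval-map-* a q n) (eval-⊗ p q n))
    (rearrange a n (eval p n) (eval q n)))
  where
  rearrange : ∀ a n s t → a * t + (0ℤ + n * (s * t)) ≡ (a + n * s) * t
  rearrange = solve-∀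

eval-const : ∀ c n → eval (const c) n ≡ c
eval-const = simplify
  where
  simplify : ∀ c n → c + n * 0ℤ ≡ c
  simplify = solve-∀

eval-X- : ∀ b n → eval (X- b) n ≡ n - b
eval-X- = simplify
  where
  simplify : ∀ b n → - b + n * (1ℤ + n * 0ℤ) ≡ n - b
  simplify = solve-∀

eval-↑ : ∀ p k n → eval (p ↑ k) n ≡ eval p n ^ k
eval-↑ p zero    n = eval-const 1ℤ n
eval-↑ p (suc k) n = trans (eval-⊗ p (p ↑ k) n) (cong (eval p n *_) (eval-↑ p k n))

roots : List ℤ → ℤ → ℤ
roots S = eval (∏ (map X-_ S))

roots-∷ : ∀ b S n → roots (b ∷ S) n ≡ (n - b) * roots S n
roots-∷ b S n = trans (eval-⊗ (X- b) (∏ (map X-_ S)) n) (cong (_* roots S n) (eval-X- b n))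

∈⇒roots≡0 : ∀ {n S} → n ∈ S → roots S n ≡ 0ℤ
∈⇒roots≡0 {n} {b ∷ S} (here refl) =
  trans (roots-∷ b S n) (cong (_* roots S n) (ℤ.+-inverseʳ n))
∈⇒roots≡0 {n} {b ∷ S} (there n∈S) =
  trans (roots-∷ b S n) (trans (cong ((n - b) *_) (∈⇒roots≡0 n∈S)) (ℤ.*-zeroʳ (n - b)))

roots≡0⇒∈ : ∀ n S → roots S n ≡ 0ℤ → n ∈ S
roots≡0⇒∈ n []      eq = contradiction (trans (sym (eval-const 1ℤ n)) eq) λ ()
roots≡0⇒∈ n (b ∷ S) eq
  with ℤ.i*j≡0⇒i≡0∨j≡0 (n - b) (trans (sym (roots-∷ b S n)) eq)
... | inj₁ n-b≡0 = here (ℤ.i-j≡0⇒i≡j n b n-b≡0)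
... | inj₂ eq′   = there (roots≡0⇒∈ n S eq′)

-- Taking `G` as an argument lets the second factor of `f` be used alike for `y ^ 4 + 1` and for
-- `x * x + 1`.
cofactor : ℤ → ℤ → ℤ
cofactor x G = (x - 1ℤ) * G + 1ℤ

eval-f : ∀ S x → (let G = roots S x ^ 4 + 1ℤ in eval (f S) x ≡ G * cofactor x G)
eval-f S x = begin
  eval (f S) x
    ≡⟨ eval-⊗ (g S) ((X- 1ℤ) ⊗ g S ⊕ const 1ℤ) x ⟩
  eval (g S) x * eval ((X- 1ℤ) ⊗ g S ⊕ const 1ℤ) x
    ≡⟨ cong (eval (g S) x *_) (eval-⊕ ((X- 1ℤ) ⊗ g S) (const 1ℤ) x) ⟩
  eval (g S) x * (eval ((X- 1ℤ) ⊗ g S) x + eval (const 1ℤ) x)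
    ≡⟨ cong₂ (λ s t → eval (g S) x * (s + t)) (eval-⊗ (X- 1ℤ) (g S) x) (eval-const 1ℤ x) ⟩
  eval (g S) x * (eval (X- 1ℤ) x * eval (g S) x + 1ℤ)
    ≡⟨ cong (λ t → eval (g S) x * (t * eval (g S) x + 1ℤ)) (eval-X- 1ℤ x) ⟩
  eval (g S) x * cofactor x (eval (g S) x)
    ≡⟨ cong (λ G → G * cofactor x G) eval-g ⟩
  (roots S x ^ 4 + 1ℤ) * cofactor x (roots S x ^ 4 + 1ℤ) ∎
  where
  open ≡-Reasoning
  P = ∏ (map X-_ S)
  eval-g : eval (g S) x ≡ roots S x ^ 4 + 1ℤ
  eval-g = trans (eval-⊕ (P ↑ 4) (const 1ℤ) x) (cong₂ _+_ (eval-↑ P 4 x) (eval-const 1ℤ x))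

∈⇒eval-f : ∀ {x S} → x ∈ S → eval (f S) x ≡ x
∈⇒eval-f {x} {S} x∈S = trans (eval-f S x)
  (trans (cong (λ y → (y ^ 4 + 1ℤ) * cofactor x (y ^ 4 + 1ℤ)) (∈⇒roots≡0 x∈S)) (simplify x))
  where
  simplify : ∀ x → 1ℤ * ((x - 1ℤ) * 1ℤ + 1ℤ) ≡ x
  simplify = solve-∀

-- Perfect powers among the values of `f`.

-- An odd `a` has only odd powers, while for even `a` and exponent at least 2 the power is divisible
-- by 4.
2*odd≢power : ∀ {i} a m → 2 ℕ.≤ m → Odd i → + 2 * i ≢ a ^ m
2*odd≢power {i} a (suc (suc m)) _ od eq with parity a
... | inj₂ a-odd = even∧odd⇒⊥ (i , sym eq) (odd-^ (suc (suc m)) a-odd)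
... | inj₁ (b , refl) = even∧odd⇒⊥ (b * (b * (+ 2 * b) ^ m) , ℤ.*-cancelˡ-≡ (+ 2) i _
    (trans eq (rearrange b ((+ 2 * b) ^ m)))) od
  where
  rearrange : ∀ b c → + 2 * b * (+ 2 * b * c) ≡ + 2 * (+ 2 * (b * (b * c)))
  rearrange = solve-∀
2*odd≢power a (suc zero) (ℕ.s≤s ()) _ _

odd⇒x²+1≡2*odd : ∀ {x} → Odd x → ∃ λ i → Odd i × x * x + 1ℤ ≡ + 2 * i
odd⇒x²+1≡2*odd (k , refl) = + 2 * (k * k + k) + 1ℤ , (k * k + k , refl) , expand k
  where
  expand : ∀ k → (+ 2 * k + 1ℤ) * (+ 2 * k + 1ℤ) + 1ℤ ≡ + 2 * (+ 2 * (k * k + k) + 1ℤ)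
  expand = solve-∀

coprime-conjugate : ∀ {x} → Even x → Coprime (x +i 1ℤ) (x +i -1ℤ)
coprime-conjugate (e , refl) =
  -- With u = x + i, x = 2 e and ū the conjugate, u - ū = 2 i gives 1 = u ū - 4 e² = u ū + 2 e² i (u
  -- - ū). The witnesses are the coefficients of u and ū.
  (+ 2 * e) +i (-1ℤ + + 2 * e * e) , 0ℤ +i (- (+ 2 * e * e)) ,
  cong₂ _+i_ (expand-re e) (expand-im e)
  where
  expand-re : ∀ e → (+ 2 * e) * (+ 2 * e) - (-1ℤ + + 2 * e * e) * 1ℤ
    + (0ℤ * (+ 2 * e) - (- (+ 2 * e * e)) * -1ℤ) ≡ 1ℤ
  expand-re = solve-∀
  expand-im : ∀ e → (+ 2 * e) * 1ℤ + (-1ℤ + + 2 * e * e) * (+ 2 * e)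
    + (0ℤ * -1ℤ + (- (+ 2 * e * e)) * (+ 2 * e)) ≡ 0ℤ
  expand-im = solve-∀

coprime-cofactor : ∀ x t → Coprime (x +i 1ℤ) (cofactor t (x * x + 1ℤ) +i 0ℤ)
coprime-cofactor x t =
  -- The cofactor is (t - 1) u ū + 1, so the coefficient of u is - (t - 1) ū.
  (- ((t - 1ℤ) * x)) +i (t - 1ℤ) , 1ᵍ , cong₂ _+i_ (expand-re x t) (expand-im x t)
  where
  expand-re : ∀ x t → - ((t - 1ℤ) * x) * x - (t - 1ℤ) * 1ℤ
    + (1ℤ * ((t - 1ℤ) * (x * x + 1ℤ) + 1ℤ) - 0ℤ * 0ℤ) ≡ 1ℤ
  expand-re = solve-∀
  expand-im : ∀ x t → - ((t - 1ℤ) * x) * 1ℤ + (t - 1ℤ) * x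
    + (1ℤ * 0ℤ + 0ℤ * ((t - 1ℤ) * (x * x + 1ℤ) + 1ℤ)) ≡ 0ℤ
  expand-im = solve-∀

real-^ : ∀ a n → (a +i 0ℤ) ^ᵍ n ≡ a ^ n +i 0ℤ
real-^ a zero    = refl
real-^ a (suc n) = trans (cong ((a +i 0ℤ) ⊠_) (real-^ a n))
  (cong₂ _+i_ (simplify-re a (a ^ n)) (simplify-im a (a ^ n)))
  where
  simplify-re : ∀ a b → a * b - 0ℤ * 0ℤ ≡ a * b
  simplify-re = solve-∀
  simplify-im : ∀ a b → a * 0ℤ + 0ℤ * b ≡ 0ℤ
  simplify-im = solve-∀

x²+1≢0 : ∀ x → x * x + 1ℤ ≢ 0ℤ
x²+1≢0 x eq = contradiction (trans (+∥z∥≡norm (x +i 1ℤ)) eq) λ eq′ →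
  ℕ.m+1+n≢0 (∣ x ∣ ℕ.* ∣ x ∣) (ℤ.+-injective eq′)

power⇒x≡0 : ∀ x t a m → 2 ℕ.≤ m →
  (x * x + 1ℤ) * cofactor t (x * x + 1ℤ) ≡ a ^ m → x ≡ 0ℤ
power⇒x≡0 x t a m 2≤m eq with parity x
-- Here x² + 1 is twice an odd number and the cofactor is odd, because x² + 1 is even.
... | inj₂ x-odd = let (i , i-odd , x²+1≡2i) = odd⇒x²+1≡2*odd x-odd in
  contradiction (trans (sym (ℤ.*-assoc (+ 2) i _)) (trans (cong (_* H) (sym x²+1≡2i)) eq))
    (2*odd≢power a m 2≤m (odd-* i-odd
      (even+1 (even-*ʳ (t - 1ℤ) (i , x²+1≡2i)))))
  where
  H = cofactor t (x * x + 1ℤ)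
... | inj₁ x-even =
  -- The conjugate of `u` and the cofactor are collected in `v`, so that `u ⊠ v` is the given power.
  let (d , r , u≡ , norm-r) = coprime-factor {u} {v} (a +i 0ℤ) m (x²+1≢0 x) coprime product
  in lebesgue r d m 2≤m norm-r x-even u≡
  where
  H = cofactor t (x * x + 1ℤ)
  u v : ℤ[i]
  u = x +i 1ℤ
  v = (x +i -1ℤ) ⊠ (H +i 0ℤ)
  coprime : Coprime u v
  coprime = 𝔾.coprime-sym {v} {u} (𝔾.coprime-* {x +i -1ℤ} {H +i 0ℤ} {u}
    (𝔾.coprime-sym {u} (coprime-conjugate x-even)) (𝔾.coprime-sym {u} (coprime-cofactor x t)))
  expand-re : ∀ x h → x * (x * h - -1ℤ * 0ℤ) - 1ℤ * (x * 0ℤ + -1ℤ * h) ≡ (x * x + 1ℤ) * h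
  expand-re = solve-∀
  expand-im : ∀ x h → x * (x * 0ℤ + -1ℤ * h) + 1ℤ * (x * h - -1ℤ * 0ℤ) ≡ 0ℤ
  expand-im = solve-∀
  product : u ⊠ v ≡ (a +i 0ℤ) ^ᵍ m
  product = trans (cong₂ _+i_ (trans (expand-re x H) eq) (expand-im x H)) (sym (real-^ a m))

power⇒∈ : ∀ S x → PerfectPower (eval (f S) x) → x ∈ S
power⇒∈ S x (a , m , 2≤m , eq) = roots≡0⇒∈ x S ([ id , id ]′ (ℤ.i*j≡0⇒i≡0∨j≡0 y y²≡0))
  where
  y = roots S x
  fourth : ∀ y → y * (y * (y * (y * 1ℤ))) ≡ y * y * (y * y)
  fourth = solve-∀
  -- Since y⁴ + 1 = (y²)² + 1, the preceding result applies with y² as its `x` and the argument of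
  -- `f` as its `t`.
  y²≡0 : y * y ≡ 0ℤ
  y²≡0 = power⇒x≡0 (y * y) x a m 2≤m (trans
    (cong (λ n → (n + 1ℤ) * cofactor x (n + 1ℤ)) (sym (fourth y))) (trans (sym (eval-f S x)) eq))

theorem4p1 : (S : List ℤ) → Unique S → All PerfectPower S →
    ((x : ℤ) → PerfectPower (eval (f S) x) ⇔ x ∈ S)
    × (Values (f S) ∩ PerfectPower) ≐ (_∈ S)
theorem4p1 S _ powers =
    (λ x → mk⇔ (power⇒∈ S x)
      (λ x∈S → subst PerfectPower (sym (∈⇒eval-f x∈S)) (All.lookup powers x∈S)))
  -- If f(n) is a power, then n lies in `S`, and therefore f(n) = n does too. Conversely, each
  -- member of `S` is its own value.
  , (λ { ((n , refl) , power) → let n∈S = power⇒∈ S n power in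
         subst (_∈ S) (sym (∈⇒eval-f n∈S)) n∈S })
  , λ {y} y∈S → (y , sym (∈⇒eval-f y∈S)) , All.lookup powers y∈S
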